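{- Let $n\ge4$ and $\mathcal G\in\mathbb G^n_S$, with orthogonal decomposition $\mathcal G=\mathcal G_{cpi}+\mathcal G_{cyclic}$. Then $\mathcal G_{cpi}$ has edge weights $\omega_j+\omega_k$ where $$\omega_j=\frac1{n-2}\Big[S_S(V_j)-\tfrac12T(\mathcal G)\Big],\qquad j=1,\dots,n,$$ and $T(\mathcal G)=T(\mathcal G_{cpi})=2\sum_{j=1}^n\omega_j$. Moreover, the length in $\mathcal G$ of every Hamiltonian circuit equals $T(\mathcal G)$ plus its length in $\mathcal G_{cyclic}=\mathcal G-\mathcal G_{cpi}$.
   Context: $\mathbb G^n_S$ is the space of complete undirected weighted graphs without loops on $V_1,\dots,V_n$ with edge weights $d_{i,j}=d_{j,i}$, identified with $\mathbb R^{\binom n2}$ with the standard inner product. $\mathbb{CPI}^n_S$ is the subspace of graphs with $d_{j,k}=\omega_j+\omega_k$ for some reals $\omega_j$; $\mathbb C^n_S$ is its orthogonal complement; $\mathcal G_{cpi},\mathcal G_{cyclic}$ are the orthogonal projections of $\mathcal G$ onto these. $S_S(V_j)=\sum_{k\ne j}d_{j,k}$ and $T(\mathcal G)=\frac1{n-1}\sum_{j=1}^nS_S(V_j)$. A Hamiltonian circuit is a closed path visiting every vertex exactly once; its length is the sum of its edge weights. -}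

module Defs where

open import Algebra.Bundles using (CommutativeRing)
open import Data.Bool.Base using (if_then_else_)
open import Data.Fin.Base using (Fin; toℕ)
open import Data.Fin.Properties using (_≟_; _<?_)
open import Data.Integer.Base using (+_)
open import Data.Nat.Base as ℕ using (ℕ; zero; suc; _∸_; _⊔_)
open import Data.Nat.DivMod using (_mod_)
import Data.Nat.Properties as ℕₚ
open import Data.Product.Base using (∃; _×_; _,_)
open import Data.Product using (∃!)
open import Data.Rational.Base as ℚ using (ℚ; 0ℚ; 1ℚ; ½; ∣_∣)
import Data.Rational.Properties as ℚₚ
open import Data.Rational.Solver using (module +-*-Solver)
open import Level using (0ℓ)
open import Relation.Binary.PropositionalEquality using (_≡_; _≢_; refl; sym; trans; cong; subst)
open import Relation.Nullary.Decidable using (does)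
open import Relation.Unary using (Pred; _∈_)

------------------------------------------------------------------------
-- The reals: Cauchy sequences of rationals, with the difference being a
-- null sequence as (setoid) equality.

record ℝ : Set where
  no-eta-equality
  constructor mkℝ
  field
    seq    : ℕ → ℚ
    cauchy : ∀ ε → 0ℚ ℚ.< ε →
             ∃ λ N → ∀ m n → N ℕ.≤ m → N ℕ.≤ n → ∣ seq m ℚ.- seq n ∣ ℚ.< ε

open ℝ public

infix 4 _≈_

record _≈_ (x y : ℝ) : Set where
  no-eta-equality
  constructor mk≈
  field
    close : ∀ ε → 0ℚ ℚ.< ε →
            ∃ λ N → ∀ n → N ℕ.≤ n → ∣ seq x n ℚ.- seq y n ∣ ℚ.< ε

open _≈_ public

private
  half-pos : ∀ ε → 0ℚ ℚ.< ε → 0ℚ ℚ.< ε ℚ.* ½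
  half-pos ε 0<ε = ℚₚ.positive⁻¹ (ε ℚ.* ½) {{ℚₚ.pos*pos⇒pos ε {{ℚ.positive 0<ε}} ½}}

  halves : ∀ ε → ε ℚ.* ½ ℚ.+ ε ℚ.* ½ ≡ ε
  halves ε = trans (sym (ℚₚ.*-distribˡ-+ ε ½ ½)) (ℚₚ.*-identityʳ ε)

  sum-small : ∀ ε a b → ∣ a ∣ ℚ.< ε ℚ.* ½ → ∣ b ∣ ℚ.< ε ℚ.* ½ → ∣ a ℚ.+ b ∣ ℚ.< ε
  sum-small ε a b p q = subst (∣ a ℚ.+ b ∣ ℚ.<_) (halves ε)
    (ℚₚ.≤-<-trans (ℚₚ.∣p+q∣≤∣p∣+∣q∣ a b) (ℚₚ.+-mono-< p q))

  quot : (ε B : ℚ) → 0ℚ ℚ.< B → ℚ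
  quot ε B 0<B = ε ℚ.* ℚ.1/_ B {{ℚₚ.pos⇒nonZero B {{ℚ.positive 0<B}}}}

  quot-pos : ∀ ε B (0<B : 0ℚ ℚ.< B) → 0ℚ ℚ.< ε → 0ℚ ℚ.< quot ε B 0<B
  quot-pos ε B 0<B 0<ε = ℚₚ.positive⁻¹ _
    {{ℚₚ.pos*pos⇒pos ε {{ℚ.positive 0<ε}} _ {{ℚₚ.1/pos⇒pos B {{ℚ.positive 0<B}}}}}}

  quot-* : ∀ ε B (0<B : 0ℚ ℚ.< B) → B ℚ.* quot ε B 0<B ≡ ε
  quot-* ε B 0<B = trans (ℚₚ.*-comm B _) (trans (ℚₚ.*-assoc ε _ B)
    (trans (cong (ε ℚ.*_) (ℚₚ.*-inverseˡ B {{ℚₚ.pos⇒nonZero B {{ℚ.positive 0<B}}}}))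
           (ℚₚ.*-identityʳ ε)))

  prod-small : ∀ ε B (0<B : 0ℚ ℚ.< B) a b →
               ∣ a ∣ ℚ.≤ B → ∣ b ∣ ℚ.< quot ε B 0<B → ∣ a ℚ.* b ∣ ℚ.< ε
  prod-small ε B 0<B a b p q =
    subst (ℚ._< ε) (sym (ℚₚ.∣p*q∣≡∣p∣*∣q∣ a b))
      (ℚₚ.≤-<-trans (ℚₚ.*-monoʳ-≤-nonNeg ∣ b ∣ {{ℚₚ.∣-∣-nonNeg b}} p)
        (subst (B ℚ.* ∣ b ∣ ℚ.<_) (quot-* ε B 0<B)
          (ℚₚ.*-monoʳ-<-pos B {{ℚ.positive 0<B}} q)))

  0<1 : 0ℚ ℚ.< 1ℚ
  0<1 = ℚₚ.positive⁻¹ 1ℚ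

  bound : ∀ x → ∃ λ B → 0ℚ ℚ.< B × (∃ λ N → ∀ n → N ℕ.≤ n → ∣ seq x n ∣ ℚ.≤ B)
  bound x = let N , h = cauchy x 1ℚ 0<1 in
                ∣ seq x N ∣ ℚ.+ 1ℚ
              , ℚₚ.positive⁻¹ _ {{ℚₚ.nonNeg+pos⇒pos ∣ seq x N ∣ {{ℚₚ.∣-∣-nonNeg (seq x N)}} 1ℚ}}
              , N , λ n N≤n → subst (λ t → ∣ t ∣ ℚ.≤ ∣ seq x N ∣ ℚ.+ 1ℚ) (eq (seq x N) (seq x n))
                  (ℚₚ.≤-trans (ℚₚ.∣p+q∣≤∣p∣+∣q∣ (seq x N) (seq x n ℚ.- seq x N))
                    (ℚₚ.+-monoʳ-≤ ∣ seq x N ∣ (ℚₚ.<⇒≤ (h n N N≤n ℕₚ.≤-refl))))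
    where
    open +-*-Solver
    eq : ∀ a b → a ℚ.+ (b ℚ.- a) ≡ b
    eq = solve 2 (λ a b → a :+ (b :- a) := b) refl

  +-diff : ∀ a b c d → (a ℚ.- c) ℚ.+ (b ℚ.- d) ≡ (a ℚ.+ b) ℚ.- (c ℚ.+ d)
  +-diff = solve 4 (λ a b c d → (a :- c) :+ (b :- d) := (a :+ b) :- (c :+ d)) refl
    where open +-*-Solver

  *-diff : ∀ a b c d → a ℚ.* (b ℚ.- d) ℚ.+ d ℚ.* (a ℚ.- c) ≡ a ℚ.* b ℚ.- c ℚ.* d
  *-diff = solve 4 (λ a b c d → a :* (b :- d) :+ d :* (a :- c) := a :* b :- c :* d) refl
    where open +-*-Solver

  trans-diff : ∀ a b c → (a ℚ.- b) ℚ.+ (b ℚ.- c) ≡ a ℚ.- c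
  trans-diff = solve 3 (λ a b c → (a :- b) :+ (b :- c) := a :- c) refl
    where open +-*-Solver

  sym-diff : ∀ a b → ℚ.- (a ℚ.- b) ≡ b ℚ.- a
  sym-diff = solve 2 (λ a b → :- (a :- b) := b :- a) refl
    where open +-*-Solver

  neg-diff : ∀ a b → ℚ.- (a ℚ.- b) ≡ (ℚ.- a) ℚ.- (ℚ.- b)
  neg-diff = solve 2 (λ a b → :- (a :- b) := (:- a) :- (:- b)) refl
    where open +-*-Solver

  neg-small : ∀ ε a b → ℚ.- a ≡ b → ∣ a ∣ ℚ.< ε → ∣ b ∣ ℚ.< ε
  neg-small ε a b eq = subst (ℚ._< ε) (trans (sym (ℚₚ.∣-p∣≡∣p∣ a)) (cong ∣_∣ eq))

  self-small : ∀ ε a b → 0ℚ ℚ.< ε → a ≡ b → ∣ a ℚ.- b ∣ ℚ.< ε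
  self-small ε a .a 0<ε refl = subst (λ t → ∣ t ∣ ℚ.< ε) (sym (ℚₚ.+-inverseʳ a)) 0<ε

  ⊔ˡ : ∀ {k} m n → m ⊔ n ℕ.≤ k → m ℕ.≤ k
  ⊔ˡ m n = ℕₚ.≤-trans (ℕₚ.m≤m⊔n m n)

  ⊔ʳ : ∀ {k} m n → m ⊔ n ℕ.≤ k → n ℕ.≤ k
  ⊔ʳ m n = ℕₚ.≤-trans (ℕₚ.m≤n⊔m m n)

infixl 6 _+_ _-_
infixl 7 _*_
infix  8 -_

fromℚ : ℚ → ℝ
fromℚ q = mkℝ (λ _ → q) (λ ε 0<ε → 0 , λ _ _ _ _ → self-small ε q q 0<ε refl)

0ℝ 1ℝ 2ℝ ½ℝ : ℝ
0ℝ = fromℚ 0ℚ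
1ℝ = fromℚ 1ℚ
2ℝ = fromℚ (+ 2 ℚ./ 1)
½ℝ = fromℚ ½

_+_ : ℝ → ℝ → ℝ
seq (x + y) n = seq x n ℚ.+ seq y n
cauchy (x + y) ε 0<ε =
  let M , hx = cauchy x (ε ℚ.* ½) (half-pos ε 0<ε)
      N , hy = cauchy y (ε ℚ.* ½) (half-pos ε 0<ε)
  in M ⊔ N , λ m n p q →
  subst (λ t → ∣ t ∣ ℚ.< ε) (+-diff (seq x m) (seq y m) (seq x n) (seq y n))
    (sum-small ε _ _ (hx m n (⊔ˡ M N p) (⊔ˡ M N q)) (hy m n (⊔ʳ M N p) (⊔ʳ M N q)))

-_ : ℝ → ℝ
seq (- x) n = ℚ.- seq x n
cauchy (- x) ε 0<ε = let N , h = cauchy x ε 0<ε in N , λ m n p q → neg-small ε _ _ (neg-diff (seq x m) (seq x n)) (h m n p q)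

_-_ : ℝ → ℝ → ℝ
x - y = x + (- y)

_*_ : ℝ → ℝ → ℝ
seq (x * y) n = seq x n ℚ.* seq y n
cauchy (x * y) ε 0<ε =
  let B , 0<B , K , hB = bound x
      C , 0<C , L , hC = bound y
      M , hy = cauchy y (quot (ε ℚ.* ½) B 0<B) (quot-pos (ε ℚ.* ½) B 0<B (half-pos ε 0<ε))
      N , hx = cauchy x (quot (ε ℚ.* ½) C 0<C) (quot-pos (ε ℚ.* ½) C 0<C (half-pos ε 0<ε))
  in (K ⊔ L) ⊔ (M ⊔ N) , λ m n p q →
  subst (λ t → ∣ t ∣ ℚ.< ε) (*-diff (seq x m) (seq y m) (seq x n) (seq y n))
    (sum-small ε _ _
      (prod-small (ε ℚ.* ½) B 0<B (seq x m) _
        (hB m (⊔ˡ K L (⊔ˡ (K ⊔ L) (M ⊔ N) p)))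
        (hy m n (⊔ˡ M N (⊔ʳ (K ⊔ L) (M ⊔ N) p)) (⊔ˡ M N (⊔ʳ (K ⊔ L) (M ⊔ N) q))))
      (prod-small (ε ℚ.* ½) C 0<C (seq y n) _
        (hC n (⊔ʳ K L (⊔ˡ (K ⊔ L) (M ⊔ N) q)))
        (hx m n (⊔ʳ M N (⊔ʳ (K ⊔ L) (M ⊔ N) p)) (⊔ʳ M N (⊔ʳ (K ⊔ L) (M ⊔ N) q)))))

private
  pointwise : ∀ x y → (∀ n → seq x n ≡ seq y n) → x ≈ y
  close (pointwise x y h) ε 0<ε = 0 , λ n _ → self-small ε _ _ 0<ε (h n)

  ≈-sym : ∀ {x y} → x ≈ y → y ≈ x
  close (≈-sym {x} {y} p) ε 0<ε = let N , h = close p ε 0<ε in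
    N , λ n q → neg-small ε _ _ (sym-diff (seq x n) (seq y n)) (h n q)

  ≈-trans : ∀ {x y z} → x ≈ y → y ≈ z → x ≈ z
  close (≈-trans {x} {y} {z} p q) ε 0<ε =
    let M , hp = close p (ε ℚ.* ½) (half-pos ε 0<ε)
        N , hq = close q (ε ℚ.* ½) (half-pos ε 0<ε)
    in M ⊔ N , λ n r →
    subst (λ t → ∣ t ∣ ℚ.< ε) (trans-diff (seq x n) (seq y n) (seq z n))
      (sum-small ε _ _ (hp n (⊔ˡ M N r)) (hq n (⊔ʳ M N r)))

  +-cong : ∀ {x x′ y y′} → x ≈ x′ → y ≈ y′ → x + y ≈ x′ + y′
  close (+-cong {x} {x′} {y} {y′} p q) ε 0<ε =
    let M , hp = close p (ε ℚ.* ½) (half-pos ε 0<ε)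
        N , hq = close q (ε ℚ.* ½) (half-pos ε 0<ε)
    in M ⊔ N , λ n r →
    subst (λ t → ∣ t ∣ ℚ.< ε) (+-diff (seq x n) (seq y n) (seq x′ n) (seq y′ n))
      (sum-small ε _ _ (hp n (⊔ˡ M N r)) (hq n (⊔ʳ M N r)))

  -‿cong : ∀ {x y} → x ≈ y → - x ≈ - y
  close (-‿cong {x} {y} p) ε 0<ε = let N , h = close p ε 0<ε in
    N , λ n q → neg-small ε _ _ (neg-diff (seq x n) (seq y n)) (h n q)

  *-cong : ∀ {x x′ y y′} → x ≈ x′ → y ≈ y′ → x * y ≈ x′ * y′
  close (*-cong {x} {x′} {y} {y′} p q) ε 0<ε =
    let B , 0<B , K , hB = bound x
        C , 0<C , L , hC = bound y′
        M , hq = close q (quot (ε ℚ.* ½) B 0<B) (quot-pos (ε ℚ.* ½) B 0<B (half-pos ε 0<ε))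
        N , hp = close p (quot (ε ℚ.* ½) C 0<C) (quot-pos (ε ℚ.* ½) C 0<C (half-pos ε 0<ε))
    in (K ⊔ L) ⊔ (M ⊔ N) , λ n r →
    subst (λ t → ∣ t ∣ ℚ.< ε) (*-diff (seq x n) (seq y n) (seq x′ n) (seq y′ n))
      (sum-small ε _ _
        (prod-small (ε ℚ.* ½) B 0<B (seq x n) _
          (hB n (⊔ˡ K L (⊔ˡ (K ⊔ L) (M ⊔ N) r))) (hq n (⊔ˡ M N (⊔ʳ (K ⊔ L) (M ⊔ N) r))))
        (prod-small (ε ℚ.* ½) C 0<C (seq y′ n) _
          (hC n (⊔ʳ K L (⊔ˡ (K ⊔ L) (M ⊔ N) r))) (hp n (⊔ʳ M N (⊔ʳ (K ⊔ L) (M ⊔ N) r)))))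

  ≈-refl : ∀ {x} → x ≈ x
  ≈-refl {x} = pointwise x x λ _ → refl

  +-assoc : ∀ x y z → (x + y) + z ≈ x + (y + z)
  +-assoc x y z = pointwise ((x + y) + z) (x + (y + z)) λ n → ℚₚ.+-assoc (seq x n) (seq y n) (seq z n)

  +-comm : ∀ x y → x + y ≈ y + x
  +-comm x y = pointwise (x + y) (y + x) λ n → ℚₚ.+-comm (seq x n) (seq y n)

  +-identityˡ : ∀ x → 0ℝ + x ≈ x
  +-identityˡ x = pointwise (0ℝ + x) x λ n → ℚₚ.+-identityˡ (seq x n)

  +-identityʳ : ∀ x → x + 0ℝ ≈ x
  +-identityʳ x = pointwise (x + 0ℝ) x λ n → ℚₚ.+-identityʳ (seq x n)

  -‿inverseˡ : ∀ x → - x + x ≈ 0ℝ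
  -‿inverseˡ x = pointwise (- x + x) 0ℝ λ n → ℚₚ.+-inverseˡ (seq x n)

  -‿inverseʳ : ∀ x → x + - x ≈ 0ℝ
  -‿inverseʳ x = pointwise (x + - x) 0ℝ λ n → ℚₚ.+-inverseʳ (seq x n)

  *-assoc : ∀ x y z → (x * y) * z ≈ x * (y * z)
  *-assoc x y z = pointwise ((x * y) * z) (x * (y * z)) λ n → ℚₚ.*-assoc (seq x n) (seq y n) (seq z n)

  *-comm : ∀ x y → x * y ≈ y * x
  *-comm x y = pointwise (x * y) (y * x) λ n → ℚₚ.*-comm (seq x n) (seq y n)

  *-identityˡ : ∀ x → 1ℝ * x ≈ x
  *-identityˡ x = pointwise (1ℝ * x) x λ n → ℚₚ.*-identityˡ (seq x n)

  *-identityʳ : ∀ x → x * 1ℝ ≈ x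
  *-identityʳ x = pointwise (x * 1ℝ) x λ n → ℚₚ.*-identityʳ (seq x n)

  distribˡ : ∀ x y z → x * (y + z) ≈ x * y + x * z
  distribˡ x y z = pointwise (x * (y + z)) (x * y + x * z) λ n → ℚₚ.*-distribˡ-+ (seq x n) (seq y n) (seq z n)

  distribʳ : ∀ x y z → (y + z) * x ≈ y * x + z * x
  distribʳ x y z = pointwise ((y + z) * x) (y * x + z * x) λ n → ℚₚ.*-distribʳ-+ (seq x n) (seq y n) (seq z n)

ℝ-commutativeRing : CommutativeRing 0ℓ 0ℓ
ℝ-commutativeRing = record
  { Carrier = ℝ
  ; _≈_ = _≈_
  ; _+_ = _+_
  ; _*_ = _*_
  ; -_ = -_
  ; 0# = 0ℝ
  ; 1# = 1ℝ
  ; isCommutativeRing = record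
    { isRing = record
      { +-isAbelianGroup = record
        { isGroup = record
          { isMonoid = record
            { isSemigroup = record
              { isMagma = record
                { isEquivalence = record { refl = ≈-refl ; sym = ≈-sym ; trans = ≈-trans }
                ; ∙-cong = +-cong
                }
              ; assoc = +-assoc
              }
            ; identity = +-identityˡ , +-identityʳ
            }
          ; inverse = -‿inverseˡ , -‿inverseʳ
          ; ⁻¹-cong = -‿cong
          }
        ; comm = +-comm
        }
      ; *-cong = *-cong
      ; *-assoc = *-assoc
      ; *-identity = *-identityˡ , *-identityʳ
      ; distrib = distribˡ , distribʳ
      }
    ; *-comm = *-comm
    }
  }

open import Algebra.Properties.CommutativeMonoid.Sum (CommutativeRing.+-commutativeMonoid ℝ-commutativeRing) public
  using (sum; sum-syntax)

-- 1/m, with the junk value 1/0 = 0.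
recip : ℕ → ℝ
recip zero    = 0ℝ
recip (suc m) = fromℚ (+ 1 ℚ./ suc m)

------------------------------------------------------------------------
-- Complete undirected weighted graphs without loops, as symmetric weight
-- matrices. The absence of loops is the zero diagonal, so a graph is
-- determined by its weights d j k with j < k.

record Graph (n : ℕ) : Set where
  field
    d        : Fin n → Fin n → ℝ
    d-sym    : ∀ j k → d j k ≈ d k j
    d-noloop : ∀ j → d j j ≈ 0ℝ

open Graph public

module _ {n : ℕ} where

  private
    module R = CommutativeRing ℝ-commutativeRing

  infix  4 _≈ᴳ_
  infixl 6 _+ᴳ_ _-ᴳ_

  _≈ᴳ_ : Graph n → Graph n → Set
  G ≈ᴳ H = ∀ j k → d G j k ≈ d H j k

  _+ᴳ_ : Graph n → Graph n → Graph n
  d        (G +ᴳ H) j k = d G j k + d H j k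
  d-sym    (G +ᴳ H) j k = R.+-cong (d-sym G j k) (d-sym H j k)
  d-noloop (G +ᴳ H) j   = R.trans (R.+-cong (d-noloop G j) (d-noloop H j)) (R.+-identityˡ 0ℝ)

  _-ᴳ_ : Graph n → Graph n → Graph n
  d        (G -ᴳ H) j k = d G j k - d H j k
  d-sym    (G -ᴳ H) j k = R.+-cong (d-sym G j k) (R.-‿cong (d-sym H j k))
  d-noloop (G -ᴳ H) j   =
    R.trans (R.+-cong (d-noloop G j) (R.-‿cong (d-noloop H j))) (R.-‿inverseʳ 0ℝ)

  -- The standard inner product of ℝ^(n choose 2), one term per edge {j , k}, j < k.
  ⟨_,_⟩ : Graph n → Graph n → ℝ
  ⟨ G , H ⟩ = ∑[ j < n ] ∑[ k < n ] (if does (j <? k) then d G j k * d H j k else 0ℝ)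

  HasCPIWeights : Graph n → (Fin n → ℝ) → Set
  HasCPIWeights G ω = ∀ j k → j ≢ k → d G j k ≈ ω j + ω k

  CPI : Pred (Graph n) 0ℓ
  CPI G = ∃ λ ω → HasCPIWeights G ω

  _⊥ : Pred (Graph n) 0ℓ → Pred (Graph n) 0ℓ
  (W ⊥) G = ∀ H → H ∈ W → ⟨ G , H ⟩ ≈ 0ℝ

  Cyclic : Pred (Graph n) 0ℓ
  Cyclic = CPI ⊥

  record IsOrthogonalDecomposition (G Gcpi Gcyclic : Graph n) : Set where
    field
      cpi∈CPI       : Gcpi ∈ CPI
      cyclic∈Cyclic : Gcyclic ∈ Cyclic
      decomposes    : G ≈ᴳ Gcpi +ᴳ Gcyclic

  S : Graph n → Fin n → ℝ
  S G j = ∑[ k < n ] (if does (k ≟ j) then 0ℝ else d G j k)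

  T : Graph n → ℝ
  T G = recip (n ∸ 1) * ∑[ j < n ] S G j

  ω : Graph n → Fin n → ℝ
  ω G j = recip (n ∸ 2) * (S G j - ½ℝ * T G)

-- A closed path v₀ , v₁ , … , vₙ₋₁ , v₀ through all n vertices.
record HamiltonianCircuit (n : ℕ) : Set where
  field
    vertex            : Fin n → Fin n
    visitsExactlyOnce : ∀ v → ∃! _≡_ (λ i → vertex i ≡ v)

open HamiltonianCircuit public

cyclicSuc : ∀ {n} → Fin n → Fin n
cyclicSuc {suc n} i = suc (toℕ i) mod suc n

circuitLength : ∀ {n} → Graph n → HamiltonianCircuit n → ℝ
circuitLength {n} G H = ∑[ i < n ] d G (vertex H i) (vertex H (cyclicSuc i))

{-# OPTIONS --safe #-}
-- Against a graph with weights w_j + w_k, the inner product is ⟨G , H⟩ = ∑ w_j S(V_j),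
-- so a graph is cyclic iff all of its vertex sums S vanish.  Hence in a decomposition
-- G and G_cpi have the same vertex sums S(V_j) = (n-2) w_j + ∑ w, and these equations
-- determine w: summing over j gives T(G) = 2 ∑ w, whence w = ω.  Conversely ω solves
-- them, so G minus the graph with weights ω_j + ω_k is cyclic.  A Hamiltonian circuit
-- meets every vertex on exactly two of its edges, so its length in G_cpi is 2 ∑ w.
module Submission where

open import Algebra.Bundles using (CommutativeRing)
open import Data.Bool.Base using (if_then_else_)
open import Data.Empty using (⊥-elim)
open import Data.Fin.Base using (Fin; zero; suc; toℕ; fromℕ; inject₁)
open import Data.Fin.Permutation using (Permutation; permutation)
open import Data.Fin.Properties as Finₚ using (_≟_; _<?_)
open import Data.Fin.Relation.Unary.Top using (view; ‵fromℕ; ‵inject₁)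
open import Data.Integer.Base as ℤ using (+_)
import Data.Integer.Properties as ℤₚ
open import Data.Integer.Solver using () renaming (module +-*-Solver to ℤ-Solver)
open import Data.Nat.Base as ℕ using (ℕ; zero; suc; _≤_; s≤s)
open import Data.Nat.DivMod using (m<n⇒m%n≡m; n%n≡0; m%n<n)
import Data.Nat.Properties as ℕₚ
open import Data.Product.Base using (∃₂; _×_; _,_; proj₁; proj₂)
open import Data.Rational.Base as ℚ using (½; 1ℚ)
import Data.Rational.Properties as ℚₚ
open import Data.Rational.Solver using (module +-*-Solver)
open import Data.Rational.Unnormalised.Base using (mkℚᵘ; *≡*)
import Data.Rational.Unnormalised.Properties as ℚᵘₚ
open import Relation.Binary.Definitions using (tri<; tri≈; tri>)
open import Relation.Binary.PropositionalEquality as ≡ using (_≡_; _≢_)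
open import Relation.Nullary.Decidable using (Dec; yes; no; does)
open import Defs

open CommutativeRing ℝ-commutativeRing
  hiding (_≈_; _+_; _*_; -_; _-_; zero)
open import Algebra.Definitions.RawMonoid +-rawMonoid
  using () renaming (_×_ to _×ℝ_)
open import Algebra.Properties.Group +-group using (∙-cancelˡ; identityʳ-unique)
open import Algebra.Properties.Semiring.Mult semiring
  using (×-assoc-*; ×-comm-*; ×-congʳ)
open import Algebra.Properties.Semiring.Sum semiring
  using (sum-cong-≋; sum-replicate; sum-replicate-zero; sum-init-last; sum-permute
        ; ∑-distrib-+; ∑-comm; *-distribˡ-sum)
open import Relation.Binary.Reasoning.Setoid setoid

-- Natural numbers and their reciprocals as reals.

-- Operations on ℝ are termwise, so a ring identity can be checked in ℚ.
≗⇒≈ : ∀ {x y} → (∀ n → seq x n ≡ seq y n) → x ≈ y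
close (≗⇒≈ {x} {y} h) ε 0<ε = 0 , λ n _ → ≡.subst (λ t → ℚ.∣ t ∣ ℚ.< ε)
  (≡.sym (≡.trans (≡.cong (ℚ._- seq y n) (h n)) (ℚₚ.+-inverseʳ (seq y n)))) 0<ε

-- As a repeated sum, `ι (suc n)` unfolds to `1ℝ + ι n`; the ring identities below treat n, n-1 and
-- n-2 this way.
ι : ℕ → ℝ
ι n = n ×ℝ 1ℝ

-- `ℚ./` reduces to lowest terms, so the fractions are compared unnormalised, where
-- cross-multiplication leaves an identity over the integers.
1/n+k/n≡[1+k]/n : ∀ k m → + 1 ℚ./ suc m ℚ.+ + k ℚ./ suc m ≡ + suc k ℚ./ suc m
1/n+k/n≡[1+k]/n k m = ℚₚ.toℚᵘ-injective
  (ℚᵘₚ.≃-trans (ℚₚ.toℚᵘ-homo-+ (+ 1 ℚ./ suc m) (+ k ℚ./ suc m))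
  (ℚᵘₚ.≃-trans (ℚᵘₚ.+-cong (ℚₚ.toℚᵘ-fromℚᵘ (mkℚᵘ (+ 1) m)) (ℚₚ.toℚᵘ-fromℚᵘ (mkℚᵘ (+ k) m)))
  (ℚᵘₚ.≃-trans (*≡* (identity (+ k) (+ suc m)))
  (ℚᵘₚ.≃-sym (ℚₚ.toℚᵘ-fromℚᵘ (mkℚᵘ (+ suc k) m))))))
  where
  identity : ∀ a b → (+ 1 ℤ.* b ℤ.+ a ℤ.* b) ℤ.* b ≡ (+ 1 ℤ.+ a) ℤ.* (b ℤ.* b)
  identity = solve 2 (λ a b → (con (+ 1) :* b :+ a :* b) :* b := (con (+ 1) :+ a) :* (b :* b)) ≡.refl
    where open ℤ-Solver

×-recip : ∀ k m → k ×ℝ recip (suc m) ≈ fromℚ (+ k ℚ./ suc m)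
×-recip zero    m = ≗⇒≈ λ _ → ≡.sym (ℚₚ.fromℚᵘ-cong {mkℚᵘ (+ 0) m} {mkℚᵘ (+ 0) 0} (*≡* ≡.refl))
×-recip (suc k) m = trans (+-congˡ (×-recip k m)) (≗⇒≈ λ _ → 1/n+k/n≡[1+k]/n k m)

-- Multiplying by `ι (suc m)` adds up m+1 copies, and m+1 copies of 1/(m+1) make (m+1)/(m+1).
recip-inverse : ∀ m → recip (suc m) * ι (suc m) ≈ 1ℝ
recip-inverse m = begin
  recip (suc m) * ι (suc m)           ≈⟨ ×-comm-* (suc m) (recip (suc m)) 1ℝ ⟩
  suc m ×ℝ (recip (suc m) * 1ℝ)       ≈⟨ ×-congʳ (suc m) (*-identityʳ (recip (suc m))) ⟩
  suc m ×ℝ recip (suc m)              ≈⟨ ×-recip (suc m) m ⟩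
  fromℚ (+ suc m ℚ./ suc m)           ≈⟨ ≗⇒≈ (λ _ → ℚₚ.fromℚᵘ-cong {mkℚᵘ (+ suc m) m} {mkℚᵘ (+ 1) 0} (*≡* (ℤₚ.*-comm (+ suc m) (+ 1)))) ⟩
  1ℝ                                  ∎

recip-cancelˡ : ∀ m x → recip (suc m) * (ι (suc m) * x) ≈ x
recip-cancelˡ m x = trans (sym (*-assoc _ _ x)) (trans (*-congʳ (recip-inverse m)) (*-identityˡ x))

ι-cancelˡ : ∀ m x → ι (suc m) * (recip (suc m) * x) ≈ x
ι-cancelˡ m x = trans (sym (*-assoc _ _ x))
  (trans (*-congʳ (trans (*-comm _ (recip (suc m))) (recip-inverse m))) (*-identityˡ x))

-- Finite sums.

∑-cong : ∀ {n} {f g : Fin n → ℝ} → (∀ i → f i ≈ g i) → ∑[ i < n ] f i ≈ ∑[ i < n ] g i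
∑-cong = sum-cong-≋

∑-const : ∀ n x → ∑[ _ < n ] x ≈ ι n * x
∑-const n x = trans (sum-replicate n)
  (sym (trans (×-assoc-* n 1ℝ x) (×-congʳ n (*-identityˡ x))))

∑-zero : ∀ {n} {f : Fin n → ℝ} → (∀ i → f i ≈ 0ℝ) → ∑[ i < n ] f i ≈ 0ℝ
∑-zero {n} h = trans (∑-cong h) (sum-replicate-zero n)

∑-except : ∀ {n} (f : Fin n → ℝ) j →
  ∑[ k < n ] (if does (k ≟ j) then 0ℝ else f k) + f j ≈ ∑[ k < n ] f k
∑-except f zero    = trans (+-congʳ (+-identityˡ _)) (+-comm _ (f zero))
∑-except f (suc j) = trans (+-assoc (f zero) _ _) (+-congˡ (∑-except (λ k → f (suc k)) j))

δ : ∀ {n} → Fin n → Fin n → ℝ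
δ j k = if does (k ≟ j) then 1ℝ else 0ℝ

∑-δ : ∀ {n} (f : Fin n → ℝ) j → ∑[ k < n ] (δ j k * f k) ≈ f j
∑-δ f zero    = trans (+-cong (*-identityˡ (f zero)) (∑-zero (λ k → zeroˡ (f (suc k))))) (+-identityʳ _)
∑-δ f (suc j) = trans (+-cong (zeroˡ (f zero)) (∑-δ (λ k → f (suc k)) j)) (+-identityˡ _)

-- Additivity of vertex sums and circuit lengths.

S-additive : ∀ {n} {G P C : Graph n} → G ≈ᴳ P +ᴳ C → ∀ j → S G j ≈ S P j + S C j
S-additive {n} {G} {P} {C} G≈P+C j = trans (∑-cong λ k → term k (k ≟ j)) (∑-distrib-+ {n} _ _)
  where
  -- Taking the decision as an argument lets one match reduce all three conditionals.
  term : ∀ k (k≟j : Dec (k ≡ j)) →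
    (if does k≟j then 0ℝ else d G j k) ≈
    (if does k≟j then 0ℝ else d P j k) + (if does k≟j then 0ℝ else d C j k)
  term k (yes _) = sym (+-identityˡ 0ℝ)
  term k (no  _) = G≈P+C j k

circuitLength-additive : ∀ {n} {G P C : Graph n} → G ≈ᴳ P +ᴳ C →
  ∀ H → circuitLength G H ≈ circuitLength P H + circuitLength C H
circuitLength-additive {n} G≈P+C H =
  trans (∑-cong λ i → G≈P+C (vertex H i) (vertex H (cyclicSuc i))) (∑-distrib-+ {n} _ _)

T-cong : ∀ {n} {G H : Graph n} → (∀ j → S G j ≈ S H j) → T G ≈ T H
T-cong h = *-congˡ (∑-cong h)

-- The inner product with CPI graphs, and cyclic graphs.

cpiGraph : ∀ {n} → (Fin n → ℝ) → Graph n
cpiGraph {n} w = record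
  { d        = λ j k → weight j k (j ≟ k)
  ; d-sym    = λ j k → weight-sym j k (j ≟ k) (k ≟ j)
  ; d-noloop = λ j → weight-loop j (j ≟ j)
  }
  where
  weight : ∀ j k → Dec (j ≡ k) → ℝ
  weight j k j≟k = if does j≟k then 0ℝ else w j + w k

  weight-sym : ∀ j k (j≟k : Dec (j ≡ k)) (k≟j : Dec (k ≡ j)) → weight j k j≟k ≈ weight k j k≟j
  weight-sym j k (yes _)   (yes _)   = refl
  weight-sym j k (yes j≡k) (no k≢j)  = ⊥-elim (k≢j (≡.sym j≡k))
  weight-sym j k (no j≢k)  (yes k≡j) = ⊥-elim (j≢k (≡.sym k≡j))
  weight-sym j k (no _)    (no _)    = +-comm (w j) (w k)

  weight-loop : ∀ j (j≟j : Dec (j ≡ j)) → weight j j j≟j ≈ 0ℝ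
  weight-loop j (yes _)  = refl
  weight-loop j (no j≢j) = ⊥-elim (j≢j ≡.refl)

cpiGraph-weights : ∀ {n} (w : Fin n → ℝ) → HasCPIWeights (cpiGraph w) w
cpiGraph-weights w j k j≢k with j ≟ k
... | yes j≡k = ⊥-elim (j≢k j≡k)
... | no  _   = refl

-- An edge with weight `w j + w k` in `H` contributes one term for each endpoint. Charging each term
-- to its endpoint turns the sum over j < k into a sum over all ordered pairs of distinct vertices,
-- whose row j is `w j * S G j`.
⟨⟩-cpi : ∀ {n} (G H : Graph n) (w : Fin n → ℝ) → HasCPIWeights H w →
  ⟨ G , H ⟩ ≈ ∑[ j < n ] (w j * S G j)
⟨⟩-cpi {n} G H w hw = begin
  ⟨ G , H ⟩
    ≈⟨ ∑-cong (λ j → trans (∑-cong λ k → split j k (j <? k)) (∑-distrib-+ {n} (upper j) (λ k → lower k j))) ⟩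
  ∑[ j < n ] (∑[ k < n ] upper j k + ∑[ k < n ] lower k j)
    ≈⟨ ∑-distrib-+ {n} (λ j → ∑[ k < n ] upper j k) (λ j → ∑[ k < n ] lower k j) ⟩
  ∑[ j < n ] (∑[ k < n ] upper j k) + ∑[ j < n ] (∑[ k < n ] lower k j)
    -- The terms charged to the larger endpoint are transposed, so that they join the row of that
    -- endpoint.
    ≈⟨ +-congˡ (∑-comm {n} {n} (λ j k → lower k j)) ⟩
  ∑[ j < n ] (∑[ k < n ] upper j k) + ∑[ j < n ] (∑[ k < n ] lower j k)
    ≈⟨ ∑-distrib-+ {n} (λ j → ∑[ k < n ] upper j k) (λ j → ∑[ k < n ] lower j k) ⟨
  ∑[ j < n ] (∑[ k < n ] upper j k + ∑[ k < n ] lower j k)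
    ≈⟨ ∑-cong row ⟩
  ∑[ j < n ] (w j * S G j) ∎
  where
  upper lower : Fin n → Fin n → ℝ
  upper j k = if does (j <? k) then w j * d G j k else 0ℝ
  lower j k = if does (k <? j) then w j * d G j k else 0ℝ

  split : ∀ j k (j<?k : Dec (toℕ j ℕ.< toℕ k)) →
    (if does j<?k then d G j k * d H j k else 0ℝ) ≈
    (if does j<?k then w j * d G j k else 0ℝ) + (if does j<?k then w k * d G k j else 0ℝ)
  split j k (no  _)   = sym (+-identityˡ 0ℝ)
  split j k (yes j<k) = begin
    d G j k * d H j k             ≈⟨ *-congˡ (hw j k (Finₚ.<⇒≢ j<k)) ⟩
    d G j k * (w j + w k)         ≈⟨ *-comm _ _ ⟩
    (w j + w k) * d G j k         ≈⟨ distribʳ (d G j k) (w j) (w k) ⟩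
    w j * d G j k + w k * d G j k ≈⟨ +-congˡ (*-congˡ (d-sym G j k)) ⟩
    w j * d G j k + w k * d G k j ∎

  -- By trichotomy exactly one of j < k, k < j, k = j holds; the diagonal gives 0 on both sides.
  merge : ∀ j k (j<?k : Dec (toℕ j ℕ.< toℕ k)) (k<?j : Dec (toℕ k ℕ.< toℕ j)) (k≟j : Dec (k ≡ j)) →
    (if does j<?k then w j * d G j k else 0ℝ) + (if does k<?j then w j * d G j k else 0ℝ) ≈
    w j * (if does k≟j then 0ℝ else d G j k)
  merge j k (yes j<k) (yes k<j) _          = ⊥-elim (ℕₚ.<-asym j<k k<j)
  merge j k (yes j<k) (no _)   (yes k≡j)   = ⊥-elim (Finₚ.<⇒≢ j<k (≡.sym k≡j))
  merge j k (yes _)   (no _)   (no _)      = +-identityʳ _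
  merge j k (no _)    (yes k<j) (yes k≡j)  = ⊥-elim (Finₚ.<⇒≢ k<j k≡j)
  merge j k (no _)    (yes _)  (no _)      = +-identityˡ _
  merge j k (no _)    (no _)   (yes _)     = trans (+-identityˡ 0ℝ) (sym (zeroʳ (w j)))
  merge j k (no j≮k)  (no k≮j) (no k≢j)    with Finₚ.<-cmp j k
  ... | tri< j<k _ _ = ⊥-elim (j≮k j<k)
  ... | tri≈ _ j≡k _ = ⊥-elim (k≢j (≡.sym j≡k))
  ... | tri> _ _ k<j = ⊥-elim (k≮j k<j)

  row : ∀ j → ∑[ k < n ] upper j k + ∑[ k < n ] lower j k ≈ w j * S G j
  row j = begin
    ∑[ k < n ] upper j k + ∑[ k < n ] lower j k
      ≈⟨ ∑-distrib-+ {n} (upper j) (lower j) ⟨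
    ∑[ k < n ] (upper j k + lower j k)
      ≈⟨ ∑-cong (λ k → merge j k (j <? k) (k <? j) (k ≟ j)) ⟩
    ∑[ k < n ] (w j * (if does (k ≟ j) then 0ℝ else d G j k))
      ≈⟨ *-distribˡ-sum {n} (w j) _ ⟨
    w j * S G j ∎

S≈0⇒Cyclic : ∀ {n} (G : Graph n) → (∀ j → S G j ≈ 0ℝ) → Cyclic G
S≈0⇒Cyclic G S≈0 H (w , hw) =
  trans (⟨⟩-cpi G H w hw) (∑-zero λ j → trans (*-congˡ (S≈0 j)) (zeroʳ (w j)))

-- Testing orthogonality against the CPI graph with indicator weights `δ j` isolates the vertex sum
-- at j.
Cyclic⇒S≈0 : ∀ {n} (G : Graph n) → Cyclic G → ∀ j → S G j ≈ 0ℝ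
Cyclic⇒S≈0 {n} G cyclic j = begin
  S G j                         ≈⟨ ∑-δ (S G) j ⟨
  ∑[ k < n ] (δ j k * S G k)    ≈⟨ ⟨⟩-cpi G (cpiGraph (δ j)) (δ j) (cpiGraph-weights (δ j)) ⟨
  ⟨ G , cpiGraph (δ j) ⟩        ≈⟨ cyclic (cpiGraph (δ j)) (δ j , cpiGraph-weights (δ j)) ⟩
  0ℝ                            ∎

-- The linear system relating weights and vertex sums.

-- Here m = n-2. The system does not ask that `G` have weights `w`, so it also applies to a graph
-- that only shares its vertex sums with a CPI graph.
VertexSumsFrom : ∀ {m} → Graph (2 ℕ.+ m) → (Fin (2 ℕ.+ m) → ℝ) → Set
VertexSumsFrom {m} G w = ∀ j → S G j ≈ ι m * w j + ∑[ k < 2 ℕ.+ m ] w k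

-- Adding the missing diagonal term `w j + w j` completes the sum over k to n copies of `w j` plus
-- the sum of `w`; that term is then cancelled.
S-cpi : ∀ {m} (P : Graph (2 ℕ.+ m)) w → HasCPIWeights P w → VertexSumsFrom P w
S-cpi {m} P w hw j = ∙-cancelˡ (w j + w j) _ _ (begin
  (w j + w j) + S P j
    ≈⟨ +-comm _ _ ⟩
  S P j + (w j + w j)
    ≈⟨ +-congʳ (∑-cong (λ k → term k (k ≟ j))) ⟩
  ∑[ k < n ] (if does (k ≟ j) then 0ℝ else w j + w k) + (w j + w j)
    ≈⟨ ∑-except (λ k → w j + w k) j ⟩
  ∑[ k < n ] (w j + w k)
    ≈⟨ ∑-distrib-+ {n} (λ _ → w j) w ⟩
  ∑[ _ < n ] w j + ∑[ k < n ] w k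
    ≈⟨ +-congʳ (∑-const n (w j)) ⟩
  ι n * w j + ∑[ k < n ] w k
    ≈⟨ ≗⇒≈ (λ i → identity (seq (ι m) i) (seq (w j) i) (seq (∑[ k < n ] w k) i)) ⟩
  (w j + w j) + (ι m * w j + ∑[ k < n ] w k) ∎)
  where
  n = 2 ℕ.+ m

  term : ∀ k (k≟j : Dec (k ≡ j)) →
    (if does k≟j then 0ℝ else d P j k) ≈ (if does k≟j then 0ℝ else w j + w k)
  term k (yes _)  = refl
  term k (no k≢j) = hw j k (λ j≡k → k≢j (≡.sym j≡k))

  open +-*-Solver
  identity : ∀ a x y → (1ℚ ℚ.+ (1ℚ ℚ.+ a)) ℚ.* x ℚ.+ y ≡ (x ℚ.+ x) ℚ.+ (a ℚ.* x ℚ.+ y)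
  identity = solve 3 (λ a x y → (con 1ℚ :+ (con 1ℚ :+ a)) :* x :+ y := (x :+ x) :+ (a :* x :+ y)) ≡.refl

-- With W the sum of `w`, summing the system over j gives (n-2)W + nW = 2(n-1)W, and `T` divides by
-- n-1.
T-fromWeights : ∀ {m} (G : Graph (2 ℕ.+ m)) w → VertexSumsFrom G w →
  T G ≈ 2ℝ * ∑[ j < 2 ℕ.+ m ] w j
T-fromWeights {m} G w hS = trans (*-congˡ (begin
  ∑[ j < n ] S G j                     ≈⟨ ∑-cong hS ⟩
  ∑[ j < n ] (ι m * w j + W)           ≈⟨ ∑-distrib-+ {n} (λ j → ι m * w j) (λ _ → W) ⟩
  ∑[ j < n ] (ι m * w j) + ∑[ _ < n ] W ≈⟨ +-cong (sym (*-distribˡ-sum {n} (ι m) w)) (∑-const n W) ⟩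
  ι m * W + ι n * W                    ≈⟨ ≗⇒≈ (λ i → identity (seq (ι m) i) (seq W i)) ⟩
  ι (suc m) * (2ℝ * W)                 ∎)) (recip-cancelˡ m (2ℝ * W))
  where
  n = 2 ℕ.+ m
  W = ∑[ j < n ] w j
  open +-*-Solver
  identity : ∀ a x → a ℚ.* x ℚ.+ (1ℚ ℚ.+ (1ℚ ℚ.+ a)) ℚ.* x ≡ (1ℚ ℚ.+ a) ℚ.* ((+ 2 ℚ./ 1) ℚ.* x)
  identity = solve 2 (λ a x → a :* x :+ (con 1ℚ :+ (con 1ℚ :+ a)) :* x
                              := (con 1ℚ :+ a) :* (con (+ 2 ℚ./ 1) :* x)) ≡.refl

-- Half of `T G` is the sum of `w`, so subtracting it from `S G j` leaves (n-2) times `w j`. Three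
-- vertices make n-2 invertible.
ω-unique : ∀ {p} (G : Graph (3 ℕ.+ p)) w → VertexSumsFrom G w → ∀ j → ω G j ≈ w j
ω-unique {p} G w hS j = trans (*-congˡ (begin
  S G j - ½ℝ * T G                       ≈⟨ +-cong (hS j) (-‿cong (*-congˡ (T-fromWeights G w hS))) ⟩
  (ι (suc p) * w j + W) - ½ℝ * (2ℝ * W)  ≈⟨ ≗⇒≈ (λ i → identity (seq (ι (suc p) * w j) i) (seq W i)) ⟩
  ι (suc p) * w j                        ∎)) (recip-cancelˡ p (w j))
  where
  W = ∑[ k < 3 ℕ.+ p ] w k
  open +-*-Solver
  identity : ∀ a x → (a ℚ.+ x) ℚ.- ½ ℚ.* ((+ 2 ℚ./ 1) ℚ.* x) ≡ a
  identity = solve 2 (λ a x → (a :+ x) :- con ½ :* (con (+ 2 ℚ./ 1) :* x) := a) ≡.refl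

-- The vertex sums add up to (n-1)T by definition of `T`, and (n-1)T - nT/2 = (n-2)T/2. This holds
-- for every graph, as the existence of the decomposition requires.
∑ω≈½T : ∀ {p} (G : Graph (3 ℕ.+ p)) → ∑[ j < 3 ℕ.+ p ] ω G j ≈ ½ℝ * T G
∑ω≈½T {p} G = begin
  ∑[ j < n ] ω G j
    ≈⟨ *-distribˡ-sum {n} (recip m) (λ j → S G j - ½ℝ * T G) ⟨
  recip m * ∑[ j < n ] (S G j - ½ℝ * T G)
    ≈⟨ *-congˡ (∑-distrib-+ {n} (S G) (λ _ → - (½ℝ * T G))) ⟩
  recip m * (∑[ j < n ] S G j + ∑[ _ < n ] (- (½ℝ * T G)))
    ≈⟨ *-congˡ (+-cong (sym (ι-cancelˡ m (∑[ j < n ] S G j))) (∑-const n (- (½ℝ * T G)))) ⟩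
  recip m * (ι (suc m) * T G + ι n * - (½ℝ * T G))
    ≈⟨ *-congˡ (≗⇒≈ (λ i → identity (seq (ι m) i) (seq (T G) i))) ⟩
  recip m * (ι m * (½ℝ * T G))
    ≈⟨ recip-cancelˡ p (½ℝ * T G) ⟩
  ½ℝ * T G ∎
  where
  n = 3 ℕ.+ p
  m = suc p
  open +-*-Solver
  identity : ∀ a t → (1ℚ ℚ.+ a) ℚ.* t ℚ.+ (1ℚ ℚ.+ (1ℚ ℚ.+ a)) ℚ.* ℚ.- (½ ℚ.* t) ≡ a ℚ.* (½ ℚ.* t)
  identity = solve 2 (λ a t → (con 1ℚ :+ a) :* t :+ (con 1ℚ :+ (con 1ℚ :+ a)) :* (:- (con ½ :* t))
                              := a :* (con ½ :* t)) ≡.refl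

ω-vertexSums : ∀ {p} (G : Graph (3 ℕ.+ p)) → VertexSumsFrom G (ω G)
ω-vertexSums {p} G j = sym (begin
  ι (suc p) * ω G j + ∑[ k < 3 ℕ.+ p ] ω G k  ≈⟨ +-cong (ι-cancelˡ p _) (∑ω≈½T G) ⟩
  (S G j - ½ℝ * T G) + ½ℝ * T G               ≈⟨ +-assoc _ _ _ ⟩
  S G j + (- (½ℝ * T G) + ½ℝ * T G)           ≈⟨ +-congˡ (-‿inverseˡ _) ⟩
  S G j + 0ℝ                                  ≈⟨ +-identityʳ _ ⟩
  S G j                                       ∎)

-- Existence of the decomposition.

≈ᴳ-decompose : ∀ {n} (G P : Graph n) → G ≈ᴳ P +ᴳ (G -ᴳ P)
≈ᴳ-decompose G P j k = ≗⇒≈ λ i → identity (seq (d G j k) i) (seq (d P j k) i)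
  where
  open +-*-Solver
  identity : ∀ a b → a ≡ b ℚ.+ (a ℚ.- b)
  identity = solve 2 (λ a b → a := b :+ (a :- b)) ≡.refl

decomposition : ∀ {p} (G : Graph (3 ℕ.+ p)) →
  IsOrthogonalDecomposition G (cpiGraph (ω G)) (G -ᴳ cpiGraph (ω G))
decomposition G = record
  { cpi∈CPI       = ω G , cpiGraph-weights (ω G)
  -- `G` and `P` have equal vertex sums, since `ω G` yields both; by additivity those of the
  -- difference vanish.
  ; cyclic∈Cyclic = S≈0⇒Cyclic (G -ᴳ P) λ j → identityʳ-unique (S P j) _
      (trans (sym (S-additive {G = G} {P} {G -ᴳ P} (≈ᴳ-decompose G P) j))
      (trans (ω-vertexSums G j) (sym (S-cpi P (ω G) (cpiGraph-weights (ω G)) j))))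
  ; decomposes    = ≈ᴳ-decompose G P
  }
  where P = cpiGraph (ω G)

-- Hamiltonian circuits.

cyclicSuc-inject₁ : ∀ {n} (i : Fin n) → cyclicSuc (inject₁ i) ≡ suc i
cyclicSuc-inject₁ {n} i = Finₚ.toℕ-injective (≡.trans (Finₚ.toℕ-fromℕ< (m%n<n (suc (toℕ (inject₁ i))) (suc n)))
  (≡.trans (≡.cong (λ k → suc k ℕ.% suc n) (Finₚ.toℕ-inject₁ i)) (m<n⇒m%n≡m (s≤s (Finₚ.toℕ<n i)))))

cyclicSuc-fromℕ : ∀ n → cyclicSuc (fromℕ n) ≡ zero
cyclicSuc-fromℕ n = Finₚ.toℕ-injective (≡.trans (Finₚ.toℕ-fromℕ< (m%n<n (suc (toℕ (fromℕ n))) (suc n)))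
  (≡.trans (≡.cong (λ k → suc k ℕ.% suc n) (Finₚ.toℕ-fromℕ n)) (n%n≡0 (suc n))))

-- The last index wraps to `zero`, which differs from it once there are two indices; any other index
-- moves up by one.
cyclicSuc≢ : ∀ {n} (i : Fin (2 ℕ.+ n)) → i ≢ cyclicSuc i
cyclicSuc≢ {n} i i≡ with view i
... | ‵fromℕ     with () ← ≡.trans i≡ (cyclicSuc-fromℕ (suc n))
... | ‵inject₁ k = ℕₚ.1+n≢n (≡.sym (≡.trans (≡.sym (Finₚ.toℕ-inject₁ k))
                     (≡.cong toℕ (≡.trans i≡ (cyclicSuc-inject₁ k)))))

-- The shift only rotates the summands: the last one wraps to `f zero` and moves to the front.
∑-cyclicSuc : ∀ {n} (f : Fin n → ℝ) → ∑[ i < n ] f (cyclicSuc i) ≈ ∑[ i < n ] f i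
∑-cyclicSuc {zero}  f = refl
∑-cyclicSuc {suc n} f = begin
  ∑[ i < suc n ] f (cyclicSuc i)
    ≈⟨ sum-init-last (λ i → f (cyclicSuc i)) ⟩
  ∑[ i < n ] f (cyclicSuc (inject₁ i)) + f (cyclicSuc (fromℕ n))
    ≈⟨ +-cong (∑-cong (λ i → reflexive (≡.cong f (cyclicSuc-inject₁ i)))) (reflexive (≡.cong f (cyclicSuc-fromℕ n))) ⟩
  ∑[ i < n ] f (suc i) + f zero
    ≈⟨ +-comm _ (f zero) ⟩
  ∑[ i < suc n ] f i ∎

-- The inverse sends a vertex to the position at which the circuit visits it.
vertexPermutation : ∀ {n} → HamiltonianCircuit n → Permutation n n
vertexPermutation H = permutation (vertex H) (λ v → proj₁ (visitsExactlyOnce H v))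
  (λ v → proj₁ (proj₂ (visitsExactlyOnce H v)))
  (λ i → proj₂ (proj₂ (visitsExactlyOnce H (vertex H i))) ≡.refl)

vertex-injective : ∀ {n} (H : HamiltonianCircuit n) {i j} → vertex H i ≡ vertex H j → i ≡ j
vertex-injective H {i} {j} eq = ≡.trans (≡.sym (unique eq)) (unique ≡.refl)
  where unique = proj₂ (proj₂ (visitsExactlyOnce H (vertex H j)))

-- Consecutive vertices are distinct, so the weights apply to each edge; every vertex is then
-- counted once as a start and once as an end of an edge.
circuitLength-cpi : ∀ {m} (P : Graph (2 ℕ.+ m)) w → HasCPIWeights P w →
  ∀ H → circuitLength P H ≈ 2ℝ * ∑[ j < 2 ℕ.+ m ] w j
circuitLength-cpi {m} P w hw H = begin
  circuitLength P H
    ≈⟨ ∑-cong (λ i → hw _ _ (λ eq → cyclicSuc≢ i (vertex-injective H eq))) ⟩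
  ∑[ i < n ] (w (vertex H i) + w (vertex H (cyclicSuc i)))
    ≈⟨ ∑-distrib-+ {n} (λ i → w (vertex H i)) (λ i → w (vertex H (cyclicSuc i))) ⟩
  ∑[ i < n ] w (vertex H i) + ∑[ i < n ] w (vertex H (cyclicSuc i))
    ≈⟨ +-congˡ (∑-cyclicSuc (λ i → w (vertex H i))) ⟩
  ∑[ i < n ] w (vertex H i) + ∑[ i < n ] w (vertex H i)
    ≈⟨ +-cong (sum-permute w (vertexPermutation H)) (sum-permute w (vertexPermutation H)) ⟨
  ∑[ j < n ] w j + ∑[ j < n ] w j
    ≈⟨ ≗⇒≈ (λ i → identity (seq (∑[ j < n ] w j) i)) ⟩
  2ℝ * ∑[ j < n ] w j ∎
  where
  n = 2 ℕ.+ m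
  open +-*-Solver
  identity : ∀ x → x ℚ.+ x ≡ (+ 2 ℚ./ 1) ℚ.* x
  identity = solve 1 (λ x → x :+ x := con (+ 2 ℚ./ 1) :* x) ≡.refl

theorem12 : (n : ℕ) → 4 ≤ n → (G : Graph n) →
    ∃₂ (λ Gcpi Gcyclic → IsOrthogonalDecomposition G Gcpi Gcyclic)
    × ((Gcpi Gcyclic : Graph n) → IsOrthogonalDecomposition G Gcpi Gcyclic →
    HasCPIWeights Gcpi (ω G)
    × T G ≈ T Gcpi
    × T Gcpi ≈ 2ℝ * (∑[ j < n ] ω G j)
    × Gcyclic ≈ᴳ G -ᴳ Gcpi
    × ((H : HamiltonianCircuit n) →
    circuitLength G H ≈ T G + circuitLength Gcyclic H))
theorem12 (suc (suc (suc (suc q)))) (s≤s (s≤s (s≤s (s≤s _)))) G =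
  (cpiGraph (ω G) , G -ᴳ cpiGraph (ω G) , decomposition G) , λ P C dec →
  let
    open IsOrthogonalDecomposition dec
    w , hw = cpi∈CPI

    S-G≈S-P : ∀ j → S G j ≈ S P j
    S-G≈S-P j = trans (S-additive {G = G} {P} {C} decomposes j)
      (trans (+-congˡ (Cyclic⇒S≈0 C cyclic∈Cyclic j)) (+-identityʳ _))

    -- The weights `w` of an arbitrary decomposition solve the system for `G` too, because the
    -- cyclic part adds nothing to the vertex sums.
    ω≈w : ∀ j → ω G j ≈ w j
    ω≈w = ω-unique G w λ j → trans (S-G≈S-P j) (S-cpi P w hw j)

    hω : HasCPIWeights P (ω G)
    hω j k j≢k = trans (hw j k j≢k) (sym (+-cong (ω≈w j) (ω≈w k)))

    T-G≈T-P : T G ≈ T P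
    T-G≈T-P = T-cong {G = G} {P} S-G≈S-P

    T-P≈2∑ω : T P ≈ 2ℝ * ∑[ j < 4 ℕ.+ q ] ω G j
    T-P≈2∑ω = T-fromWeights P (ω G) (S-cpi P (ω G) hω)
  in
  hω , T-G≈T-P , T-P≈2∑ω
  , (λ j k → sym (trans (+-congʳ (trans (decomposes j k) (+-comm _ _)))
      (trans (+-assoc _ _ _) (trans (+-congˡ (-‿inverseʳ _)) (+-identityʳ _)))))
  , λ H → begin
      circuitLength G H
        ≈⟨ circuitLength-additive {G = G} {P} {C} decomposes H ⟩
      circuitLength P H + circuitLength C H
        -- The length in `P` and `T G` both equal twice the sum of `ω G`.
        ≈⟨ +-congʳ (trans (circuitLength-cpi P (ω G) hω H) (sym (trans T-G≈T-P T-P≈2∑ω))) ⟩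
      T G + circuitLength C H ∎
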